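{- For every positive integer $n$: - if $n\equiv 3\pmod 4$, then $t(3,4,5;n)=2N(3,4,5;2n+3)$; - if $n\equiv 1\pmod 4$, then $t(3,5,20;n)=2N(3,5,20;2n+7)$; - if $n\equiv 3\pmod 4$, then $t(3,5,36;n)=2N(3,5,36;2n+11)$; - if $n\equiv 1\pmod 4$, then $t(3,5,12;n)=\frac12N(3,5,12;8n+20)$.
   Context: For positive integers $a,b,c$ and $n\in\mathbb{N}=\{0,1,2,\dots\}$, $N(a,b,c;n)$ denotes the number of triples $(x,y,z)\in\mathbb{Z}^3$ with $n=ax^2+by^2+cz^2$, and $t(a,b,c;n)$ denotes the number of triples $(x,y,z)\in\mathbb{Z}^3$ with $n=a\frac{x(x+1)}2+b\frac{y(y+1)}2+c\frac{z(z+1)}2$. -}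

module Defs where

open import Data.Nat as ℕ using (ℕ; zero; suc)
open import Data.Nat.DivMod using (_/_)
open import Data.Integer as ℤ using (ℤ; +_; -[1+_]; ∣_∣)
open import Data.List using (List; []; _∷_; map; length; filter; concatMap; upTo)
open import Data.Product using (_×_; _,_)
open import Relation.Nullary.Decidable using (Dec)

intRange : ℕ → List ℤ
intRange B = map (λ k → -[1+ k ]) (upTo (suc B)) Data.List.++ map +_ (upTo (suc (suc B)))

box : ℕ → List (ℤ × ℤ × ℤ)
box B = concatMap (λ x → concatMap (λ y → map (λ z → (x , y , z)) (intRange B)) (intRange B)) (intRange B)

-- the triangular number x(x+1)/2 for x ∈ ℤ (x(x+1) ≥ 0 is always even)
tri : ℤ → ℕ
tri x = ∣ x ℤ.* (x ℤ.+ ℤ.1ℤ) ∣ / 2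

Q : ℕ → ℕ → ℕ → ℤ × ℤ × ℤ → ℤ
Q a b c (x , y , z) = (+ a) ℤ.* (x ℤ.* x) ℤ.+ (+ b) ℤ.* (y ℤ.* y) ℤ.+ (+ c) ℤ.* (z ℤ.* z)

T : ℕ → ℕ → ℕ → ℤ × ℤ × ℤ → ℕ
T a b c (x , y , z) = a ℕ.* tri x ℕ.+ b ℕ.* tri y ℕ.+ c ℕ.* tri z

-- N(a,b,c;n) = #{(x,y,z) ∈ ℤ³ : n = a x² + b y² + c z²}.
-- For a,b,c ≥ 1 every solution satisfies |x|,|y|,|z| ≤ n, so counting inside
-- the box [-(n+1), n+1]³ counts all solutions.
N : ℕ → ℕ → ℕ → ℕ → ℕ
N a b c n = length (filter (λ p → (+ n) ℤ.≟ Q a b c p) (box n))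

-- t(a,b,c;n) = #{(x,y,z) ∈ ℤ³ : n = a x(x+1)/2 + b y(y+1)/2 + c z(z+1)/2}.
-- For a,b,c ≥ 1 every solution satisfies -(n+1) ≤ x,y,z ≤ n, so counting
-- inside the box [-(n+1), n+1]³ counts all solutions.
t : ℕ → ℕ → ℕ → ℕ → ℕ
t a b c n = length (filter (λ p → n ℕ.≟ T a b c p) (box n))

-- By completing squares, t(3,5,4d;n) counts the odd solutions of 4m = 3x² + 5y² + 4dz², where m = 2n + 2 + d.
--
-- If n ≡ 1 (mod 4), then 3x² + 5y² = 16r with r odd. As 2 splits in ℚ(√-15) into two primes whose squares are
-- generated by (1 ± √-15)/2, each solution of r = 3u² + 5v² gives rise to exactly two such (x, y), namely
-- (u ± 5v, v ∓ 3u). Hence t is twice the number of solutions of m = 12u² + 20v² + dz².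
--
-- If n ≡ 3 (mod 4), then 3x² + 5y² = 32r, and (u, v) ↦ ((u ± 5v)/2, (v ∓ 3u)/2) is a bijection between the odd
-- solutions of 8r = 3u² + 5v² and those of 32r = 3x² + 5y², the sign being forced by the requirement that the
-- images be odd. For d = 1 and d = 9, the resulting form 3u² + 5v² + dz² contains a multiple of X² + 3Y², and
-- (X, Y) = (x ∓ 3y, y ± x) is a two-to-one correspondence between the odd solutions of 4r = X² + 3Y² and the
-- solutions of r = x² + 3y², r odd.
--
-- Congruences modulo 4 and 8 show which coordinates of a solution counted by N are even. The solutions counted by
-- N(3,5,12;4m) are the odd ones and the (2x, 2y, z) with m = 3x² + 5y² + 3z²; in the latter y and exactly one of
-- x, z are even, so both kinds are twice as numerous as the solutions of m = 12u² + 20v² + 3z².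

module Submission where

open import Defs
open import Data.Nat as ℕ using (ℕ; s≤s)
open import Data.Nat.Divisibility using (divides; _∣?_)
open import Data.Nat.DivMod using (_/_; m≡m%n+[m/n]*n; m*n/n≡m)
import Data.Nat.Properties as ℕ
open import Data.Integer as ℤ using (ℤ; +_; -[1+_]; ∣_∣)
open import Data.Integer.DivMod using (_%ℕ_; _/ℕ_; a≡a%ℕn+[a/ℕn]*n; n%ℕd<d)
import Data.Integer.Properties as ℤ
open import Data.Integer.Tactic.RingSolver using (solve; solve-∀)
open import Data.List using (List; []; _∷_; map; length; filter; _++_; concatMap; upTo; cartesianProduct; cartesianProductWith)
open import Data.List.Properties using (length-++; map-∘; map-concatMap; concatMap-cong)
open import Data.List.Membership.Propositional using (_∈_)
open import Data.List.Membership.Propositional.Properties using (∈-++⁺ˡ; ∈-++⁺ʳ; ∈-++⁻; ∈-filter⁺; ∈-filter⁻; ∈-map⁺; ∈-map⁻; ∈-upTo⁺; ∈-cartesianProduct⁺)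
open import Data.List.Membership.Propositional.Properties.WithK using (unique∧set⇒bag)
open import Data.List.Relation.Binary.BagAndSetEquality using (∼bag⇒↭)
open import Data.List.Relation.Binary.Permutation.Propositional.Properties using (↭-length)
open import Data.List.Relation.Unary.Any using (here; there)
open import Data.List.Relation.Unary.Unique.Propositional using (Unique)
import Data.List.Relation.Unary.Unique.Propositional.Properties as Unique
open import Data.Product using (∃; _×_; _,_; proj₁; proj₂)
open import Data.Sum as Sum using (_⊎_; inj₁; inj₂; [_,_]′)
open import Data.Empty using (⊥; ⊥-elim)
open import Function using (_∘_; mk⇔)
open import Level using (0ℓ)
open import Relation.Binary.PropositionalEquality using (_≡_; _≢_; refl; sym; trans; cong; cong₂; subst; module ≡-Reasoning)
open import Relation.Nullary.Decidable using (False; toWitnessFalse)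
open import Relation.Unary using (Pred; Decidable)

-- Cardinalities of predicates and their behaviour under bijections, disjoint unions and two-to-one
-- correspondences.

module Counting where

  open import Data.List.Relation.Binary.Pointwise as Pointwise using (Pointwise; []; _∷_)
  open import Data.List.Relation.Unary.All using (All; []; _∷_)
  open import Data.List.Relation.Unary.AllPairs using ([]; _∷_)

  private variable
    A B : Set
    P : Pred A 0ℓ

  -- Elements of `A` are counted through a duplicate-free list, not pairs of an element and a proof,
  -- so a predicate with several proofs at one point is not overcounted.
  record HasCard (P : Pred A 0ℓ) (k : ℕ) : Set where
    field
      elements : List A
      unique   : Unique elements
      sound    : ∀ {x} → x ∈ elements → P x
      complete : ∀ {x} → P x → x ∈ elements
      size     : length elements ≡ k

  open HasCard

  -- Duplicate-free lists with the same members are equal as bags, hence permutations of each other.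
  -- Every final identity comes from counting one solution set in two ways and comparing by this
  -- lemma.
  card-unique : ∀ {j k} → HasCard P j → HasCard P k → j ≡ k
  card-unique c d = trans (sym (size c)) (trans (↭-length (∼bag⇒↭ bag)) (size d))
    where
    bag = unique∧set⇒bag (unique c) (unique d)
            (mk⇔ (complete d ∘ sound c) (complete c ∘ sound d))

  card-filter : ∀ {xs} (P? : Decidable P) → Unique xs → (∀ {x} → P x → x ∈ xs) →
                HasCard P (length (filter P? xs))
  card-filter {xs = xs} P? u covers = record
    { elements = filter P? xs
    ; unique   = Unique.filter⁺ P? u
    ; sound    = proj₂ ∘ ∈-filter⁻ P? {xs = xs}
    ; complete = λ p → ∈-filter⁺ P? (covers p) p
    ; size     = refl
    }

  card-∪ : ∀ {j k} {P Q R : Pred A 0ℓ} → HasCard P j → HasCard Q k →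
           (∀ {x} → P x → R x) → (∀ {x} → Q x → R x) → (∀ {x} → R x → P x ⊎ Q x) →
           (∀ {x} → P x → Q x → ⊥) → HasCard R (j ℕ.+ k)
  card-∪ c d P⊆R Q⊆R R⊆P∪Q disjoint = record
    { elements = elements c ++ elements d
    ; unique   = Unique.++⁺ (unique c) (unique d) λ (p , q) → disjoint (sound c p) (sound d q)
    ; sound    = [ P⊆R ∘ sound c , Q⊆R ∘ sound d ]′ ∘ ∈-++⁻ (elements c)
    ; complete = [ ∈-++⁺ˡ ∘ complete c , ∈-++⁺ʳ (elements c) ∘ complete d ]′ ∘ R⊆P∪Q
    ; size     = trans (length-++ (elements c)) (cong₂ ℕ._+_ (size c) (size d))
    }

  -- A bijection given as a relation, since the correspondence in `Twist` picks one of two linear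
  -- maps by a congruence. Uniqueness is demanded only between members of `P` and `Q`, because there
  -- it rests on their parity.
  record Matching (P : Pred A 0ℓ) (Q : Pred B 0ℓ) (_∼_ : A → B → Set) : Set where
    field
      total      : ∀ {a} → P a → ∃ λ b → Q b × a ∼ b
      cototal    : ∀ {b} → Q b → ∃ λ a → P a × a ∼ b
      functional : ∀ {a b b′} → P a → Q b → Q b′ → a ∼ b → a ∼ b′ → b ≡ b′
      injective  : ∀ {a a′ b} → P a → P a′ → Q b → a ∼ b → a′ ∼ b → a ≡ a′

  card-matching : ∀ {A B : Set} {P : Pred A 0ℓ} {Q : Pred B 0ℓ} {_∼_ : A → B → Set} {k} →
                  Matching P Q _∼_ → HasCard P k → HasCard Q k
  card-matching {A = A} {B = B} {P = P} {Q = Q} {_∼_ = _∼_} M c =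
    let ys , xs∼ys = image (elements c) (sound c) in record
    { elements = ys
    ; unique   = image-unique xs∼ys (unique c)
    ; sound    = λ y∈ys → let _ , _ , q , _ = preimage∈ xs∼ys y∈ys in q
    -- A partner of the given element occurs in the first list; what it was paired with in `ys` is
    -- that element again, by functionality.
    ; complete = λ q → let _ , p , a∼b = cototal q
                           _ , b′∈ys , _ , q′ , a∼b′ = image∈ xs∼ys (complete c p)
                       in subst (_∈ ys) (functional p q′ q a∼b′ a∼b) b′∈ys
    ; size     = trans (sym (Pointwise.Pointwise-length xs∼ys)) (size c)
    }
    where
    open Matching M

    _≈_ : A → B → Set
    a ≈ b = P a × Q b × a ∼ b

    image : ∀ xs → (∀ {x} → x ∈ xs → P x) → ∃ λ ys → Pointwise _≈_ xs ys
    image []       _ = [] , []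
    image (x ∷ xs) p = let b , q , a∼b = total (p (here refl))
                           ys , xs≈ys = image xs (p ∘ there)
                       in b ∷ ys , (p (here refl) , q , a∼b) ∷ xs≈ys

    image-fresh : ∀ {x y xs ys} → x ≈ y → Pointwise _≈_ xs ys → All (x ≢_) xs → All (y ≢_) ys
    image-fresh _  []             []           = []
    image-fresh x≈y@(p , q , r) ((p′ , _ , r′) ∷ xs≈ys) (x≢x′ ∷ x∉xs) =
      (λ { refl → x≢x′ (injective p p′ q r r′) }) ∷ image-fresh x≈y xs≈ys x∉xs

    image-unique : ∀ {xs ys} → Pointwise _≈_ xs ys → Unique xs → Unique ys
    image-unique []            []         = []
    image-unique (x≈y ∷ xs≈ys) (x∉xs ∷ u) = image-fresh x≈y xs≈ys x∉xs ∷ image-unique xs≈ys u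

    image∈ : ∀ {xs ys a} → Pointwise _≈_ xs ys → a ∈ xs → ∃ λ b → b ∈ ys × a ≈ b
    image∈ (x≈y ∷ _)  (here refl) = _ , here refl , x≈y
    image∈ (_ ∷ xs≈ys) (there a∈) = let b , b∈ , a≈b = image∈ xs≈ys a∈ in b , there b∈ , a≈b

    preimage∈ : ∀ {xs ys b} → Pointwise _≈_ xs ys → b ∈ ys → ∃ λ a → a ≈ b
    preimage∈ (x≈y ∷ _)  (here refl) = _ , x≈y
    preimage∈ (_ ∷ xs≈ys) (there b∈) = preimage∈ xs≈ys b∈

  Image : (A → B) → Pred A 0ℓ → Pred B 0ℓ
  Image f P b = ∃ λ a → P a × f a ≡ b

  card-map : ∀ {Q : Pred B 0ℓ} {k} (f : A → B) → (∀ {a a′} → f a ≡ f a′ → a ≡ a′) →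
             (∀ {a} → P a → Q (f a)) → (∀ {b} → Q b → Image f P b) →
             HasCard P k → HasCard Q k
  card-map f f-inj P⇒Q onto = card-matching {_∼_ = λ a b → f a ≡ b} record
    { total      = λ p → f _ , P⇒Q p , refl
    ; cototal    = onto
    ; functional = λ { _ _ _ refl refl → refl }
    ; injective  = λ { _ _ _ e e′ → f-inj (trans e (sym e′)) }
    }

  card-Image : ∀ {k} (f : A → B) → (∀ {a a′} → f a ≡ f a′ → a ≡ a′) →
               HasCard P k → HasCard (Image f P) k
  card-Image f f-inj = card-map f f-inj (λ p → _ , p , refl) (λ q → q)

  card-double : ∀ {Q : Pred B 0ℓ} {k} (f g : A → B) →
                (∀ {a a′} → f a ≡ f a′ → a ≡ a′) → (∀ {a a′} → g a ≡ g a′ → a ≡ a′) →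
                (∀ {a} → P a → Q (f a)) → (∀ {a} → P a → Q (g a)) →
                (∀ {b} → Q b → Image f P b ⊎ Image g P b) →
                (∀ {a a′} → P a → P a′ → f a ≢ g a′) →
                HasCard P k → HasCard Q (k ℕ.+ k)
  card-double f g f-inj g-inj P⇒Qf P⇒Qg onto apart c =
    card-∪ (card-Image f f-inj c) (card-Image g g-inj c)
      (λ { (_ , p , refl) → P⇒Qf p }) (λ { (_ , p , refl) → P⇒Qg p }) onto
      (λ { (_ , p , e) (_ , p′ , e′) → apart p p′ (trans e (sym e′)) })

  card-involution : ∀ {P Q : Pred A 0ℓ} {k} (σ : A → A) → (∀ a → σ (σ a) ≡ a) →
                    (∀ {a} → P a → Q (σ a)) → (∀ {a} → Q a → P (σ a)) →
                    HasCard P k → HasCard Q k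
  card-involution σ σσ P⇒Q Q⇒P =
    card-map σ (λ {a} {a′} e → trans (sym (σσ a)) (trans (cong σ e) (σσ a′))) P⇒Q
      (λ q → _ , Q⇒P q , σσ _)

  card-⇔ : ∀ {P Q : Pred A 0ℓ} {k} → (∀ {a} → P a → Q a) → (∀ {a} → Q a → P a) →
           HasCard P k → HasCard Q k
  card-⇔ = card-involution (λ a → a) (λ _ → refl)

  -- In the applications `f` is multiplication by a quadratic integer and `σ` is conjugation, so
  -- `σ ∘ f ∘ σ` is multiplication by the conjugate integer. If `σ b` is `f a`, then `b` is the
  -- image of `σ a` under this second map.
  card-double-conjugate : ∀ {P Q : Pred A 0ℓ} {k} (σ f : A → A) → (∀ a → σ (σ a) ≡ a) →
                          (∀ {a a′} → f a ≡ f a′ → a ≡ a′) →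
                          (∀ {a} → P a → P (σ a)) → (∀ {a} → Q a → Q (σ a)) →
                          (∀ {a} → P a → Q (f a)) →
                          (∀ {b} → Q b → Image f P b ⊎ Image f P (σ b)) →
                          (∀ {a a′} → P a → P a′ → f a ≢ σ (f (σ a′))) →
                          HasCard P k → HasCard Q (k ℕ.+ k)
  card-double-conjugate σ f σσ f-inj σP σQ P⇒Q onto =
    card-double f (σ ∘ f ∘ σ) f-inj (σ-inj ∘ f-inj ∘ σ-inj) P⇒Q (σQ ∘ P⇒Q ∘ σP)
      ([ inj₁ , (λ { (a , p , e) → inj₂ (σ a , σP p ,
         trans (cong (σ ∘ f) (σσ a)) (trans (cong σ e) (σσ _))) }) ]′ ∘ onto)
    where
    σ-inj : ∀ {a a′} → σ a ≡ σ a′ → a ≡ a′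
    σ-inj {a} {a′} e = trans (sym (σσ a)) (trans (cong σ e) (σσ a′))

open Counting

-- The search boxes contain all solutions; triangular numbers as odd squares.

module Enumeration where

  open import Data.Nat using (zero; suc; _+_; _*_; _≤_; z≤n; NonZero; _≟_)
  open import Data.Nat.Properties using (≤-refl; ≤-reflexive; ≤-trans; n≤1+n; m≤n⇒m≤1+n; m≤m+n; m≤n+m; m≤m*n; m≤n*m; +-comm; *-comm; *-distribˡ-+; *-distribʳ-+)

  intRange-unique : ∀ B → Unique (intRange B)
  intRange-unique B = Unique.++⁺ (Unique.map⁺ {f = -[1+_]} (λ { refl → refl }) (Unique.upTo⁺ (suc B)))
                                 (Unique.map⁺ {f = +_} (λ { refl → refl }) (Unique.upTo⁺ (suc (suc B))))
                                 λ (p , q) → signs (∈-map⁻ -[1+_] p) (∈-map⁻ +_ q)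
    where
    signs : ∀ {x xs ys} → (∃ λ k → k ∈ xs × x ≡ -[1+ k ]) → (∃ λ k → k ∈ ys × x ≡ + k) → ⊥
    signs (_ , _ , refl) (_ , _ , ())

  ∈-intRange : ∀ {B} x → ∣ x ∣ ≤ suc B → x ∈ intRange B
  ∈-intRange {B} (+ k)    k≤ = ∈-++⁺ʳ (map -[1+_] (upTo (suc B))) (∈-map⁺ +_ (∈-upTo⁺ (s≤s k≤)))
  ∈-intRange     -[1+ k ] k< = ∈-++⁺ˡ (∈-map⁺ -[1+_] (∈-upTo⁺ k<))

  concatMap-map≡cartesianProductWith : ∀ {A B C : Set} (f : A → B → C) xs ys →
    concatMap (λ x → map (f x) ys) xs ≡ cartesianProductWith f xs ys
  concatMap-map≡cartesianProductWith f []       ys = refl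
  concatMap-map≡cartesianProductWith f (x ∷ xs) ys =
    cong (map (f x) ys ++_) (concatMap-map≡cartesianProductWith f xs ys)

  -- Uniqueness and membership for the nested enumeration are inherited from Cartesian products.
  box≡ : ∀ B → box B ≡ cartesianProduct (intRange B) (cartesianProduct (intRange B) (intRange B))
  box≡ B = begin
    concatMap (λ x → concatMap (λ y → map (λ z → x , y , z) R) R) R
      ≡⟨ concatMap-cong (λ x → begin
           concatMap (λ y → map (λ z → x , y , z) R) R
             ≡⟨ concatMap-cong (λ y → map-∘ R) R ⟩
           concatMap (λ y → map (x ,_) (map (y ,_) R)) R
             ≡⟨ map-concatMap (x ,_) (λ y → map (y ,_) R) R ⟨
           map (x ,_) (concatMap (λ y → map (y ,_) R) R)
             ≡⟨ cong (map (x ,_)) (concatMap-map≡cartesianProductWith _,_ R R) ⟩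
           map (x ,_) (cartesianProduct R R) ∎) R ⟩
    concatMap (λ x → map (x ,_) (cartesianProduct R R)) R
      ≡⟨ concatMap-map≡cartesianProductWith _,_ R _ ⟩
    cartesianProduct R (cartesianProduct R R) ∎
    where
    open ≡-Reasoning
    R = intRange B

  box-unique : ∀ B → Unique (box B)
  box-unique B = subst Unique (sym (box≡ B))
    (Unique.cartesianProduct⁺ u (Unique.cartesianProduct⁺ u u))
    where u = intRange-unique B

  ∈-box : ∀ {B x y z} → ∣ x ∣ ≤ suc B → ∣ y ∣ ≤ suc B → ∣ z ∣ ≤ suc B → (x , y , z) ∈ box B
  ∈-box {B} p q r = subst (_∈_ _) (sym (box≡ B))
    (∈-cartesianProduct⁺ (∈-intRange _ p) (∈-cartesianProduct⁺ (∈-intRange _ q) (∈-intRange _ r)))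

  *-square : ∀ x → x ℤ.* x ≡ + (∣ x ∣ * ∣ x ∣)
  *-square (+ zero)  = refl
  *-square (+ suc n) = refl
  *-square -[1+ n ]  = refl

  Q≡+ : ∀ a b c x y z →
        Q a b c (x , y , z) ≡ + (a * (∣ x ∣ * ∣ x ∣) + b * (∣ y ∣ * ∣ y ∣) + c * (∣ z ∣ * ∣ z ∣))
  Q≡+ a b c x y z = begin
    + a ℤ.* (x ℤ.* x) ℤ.+ + b ℤ.* (y ℤ.* y) ℤ.+ + c ℤ.* (z ℤ.* z)
      ≡⟨ cong₂ ℤ._+_ (cong₂ ℤ._+_ (term a x) (term b y)) (term c z) ⟩
    + (a * (∣ x ∣ * ∣ x ∣)) ℤ.+ + (b * (∣ y ∣ * ∣ y ∣)) ℤ.+ + (c * (∣ z ∣ * ∣ z ∣)) ∎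
    where
    open ≡-Reasoning
    term : ∀ k u → + k ℤ.* (u ℤ.* u) ≡ + (k * (∣ u ∣ * ∣ u ∣))
    term k u = trans (cong (+ k ℤ.*_) (*-square u)) (sym (ℤ.pos-* k _))

  m≤m*m : ∀ m → m ≤ m * m
  m≤m*m zero    = z≤n
  m≤m*m (suc m) = m≤m*n (suc m) (suc m)

  summands≤ : ∀ a b c .{{_ : NonZero a}} .{{_ : NonZero b}} .{{_ : NonZero c}} {u v w n} →
              n ≡ a * u + b * v + c * w → u ≤ n × v ≤ n × w ≤ n
  summands≤ a b c {u} {v} {w} refl =
      ≤-trans (m≤n*m u a) (≤-trans (m≤m+n _ (b * v)) (m≤m+n _ (c * w)))
    , ≤-trans (m≤n*m v b) (≤-trans (m≤n+m _ (a * u)) (m≤m+n _ (c * w)))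
    , ≤-trans (m≤n*m w c) (m≤n+m _ (a * u + b * v))

  card-N : ∀ a b c n .{{_ : NonZero a}} .{{_ : NonZero b}} .{{_ : NonZero c}} →
           HasCard (λ p → + n ≡ Q a b c p) (N a b c n)
  card-N a b c n = card-filter (λ p → + n ℤ.≟ Q a b c p) (box-unique n) λ { {x , y , z} e →
    let p , q , r = summands≤ a b c (ℤ.+-injective (trans e (Q≡+ a b c x y z)))
    in ∈-box (bound x p) (bound y q) (bound z r) }
    where
    bound : ∀ x → ∣ x ∣ * ∣ x ∣ ≤ n → ∣ x ∣ ≤ suc n
    bound x x²≤n = m≤n⇒m≤1+n (≤-trans (m≤m*m ∣ x ∣) x²≤n)

  triangle : ℕ → ℕ
  triangle zero    = 0
  triangle (suc m) = suc m + triangle m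

  m≤triangle : ∀ m → m ≤ triangle m
  m≤triangle zero    = z≤n
  m≤triangle (suc m) = m≤m+n (suc m) (triangle m)

  triangle*2 : ∀ m → triangle m * 2 ≡ m * suc m
  triangle*2 zero    = refl
  triangle*2 (suc m) = begin
    (suc m + triangle m) * 2     ≡⟨ *-distribʳ-+ 2 (suc m) (triangle m) ⟩
    suc m * 2 + triangle m * 2   ≡⟨ cong (_+_ (suc m * 2)) (triangle*2 m) ⟩
    suc m * 2 + m * suc m        ≡⟨ cong (_+_ (suc m * 2)) (*-comm m (suc m)) ⟩
    suc m * 2 + suc m * m        ≡⟨ *-distribˡ-+ (suc m) 2 m ⟨
    suc m * suc (suc m)          ∎
    where open ≡-Reasoning

  -- The integers m and -1 - m give the same product, so a natural `m` serves both signs; the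
  -- negative one has absolute value m + 1, whence the `suc`.
  consecutive : ∀ x → ∃ λ m → x ℤ.* (x ℤ.+ ℤ.1ℤ) ≡ + (triangle m * 2) × ∣ x ∣ ≤ suc m
  consecutive (+ m) = m , product , n≤1+n m
    where
    product : + m ℤ.* (+ m ℤ.+ ℤ.1ℤ) ≡ + (triangle m * 2)
    product = trans (sym (ℤ.pos-* m (m + 1)))
                    (cong +_ (trans (cong (m *_) (+-comm m 1)) (sym (triangle*2 m))))
  consecutive -[1+ m ] = m , product , ≤-refl
    where
    negate : ∀ u → (ℤ.- (ℤ.1ℤ ℤ.+ u)) ℤ.* (ℤ.- (ℤ.1ℤ ℤ.+ u) ℤ.+ ℤ.1ℤ) ≡ u ℤ.* (ℤ.1ℤ ℤ.+ u)
    negate = solve-∀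
    product : -[1+ m ] ℤ.* (-[1+ m ] ℤ.+ ℤ.1ℤ) ≡ + (triangle m * 2)
    product = trans (negate (+ m)) (trans (sym (ℤ.pos-* m (suc m))) (cong +_ (sym (triangle*2 m))))

  -- The product is twice a triangular number, so the truncating division in `tri` is exact. The
  -- bound keeps every solution counted by `t` inside the box of radius n + 1.
  tri*2 : ∀ x → x ℤ.* (x ℤ.+ ℤ.1ℤ) ≡ + (tri x * 2) × ∣ x ∣ ≤ suc (tri x)
  tri*2 x =
    let m , e , ∣x∣≤ = consecutive x
        tri≡ : tri x ≡ triangle m
        tri≡ = trans (cong (λ k → ∣ k ∣ / 2) e) (m*n/n≡m (triangle m) 2)
    in trans e (cong (λ k → + (k * 2)) (sym tri≡))
     , ≤-trans ∣x∣≤ (s≤s (≤-trans (m≤triangle m) (≤-reflexive (sym tri≡))))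

  twice+1 : ℤ → ℤ
  twice+1 x = + 2 ℤ.* x ℤ.+ + 1

  odd-square : ∀ x → twice+1 x ℤ.* twice+1 x ≡ + 8 ℤ.* + tri x ℤ.+ + 1
  odd-square x = begin
    twice+1 x ℤ.* twice+1 x                    ≡⟨ expand x ⟩
    + 4 ℤ.* (x ℤ.* (x ℤ.+ ℤ.1ℤ)) ℤ.+ + 1       ≡⟨ cong (λ k → + 4 ℤ.* k ℤ.+ + 1) (proj₁ (tri*2 x)) ⟩
    + 4 ℤ.* + (tri x * 2) ℤ.+ + 1              ≡⟨ cong (λ k → + 4 ℤ.* k ℤ.+ + 1) (ℤ.pos-* (tri x) 2) ⟩
    + 4 ℤ.* (+ tri x ℤ.* + 2) ℤ.+ + 1          ≡⟨ regroup (+ tri x) ⟩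
    + 8 ℤ.* + tri x ℤ.+ + 1                    ∎
    where
    open ≡-Reasoning
    expand : ∀ x → (+ 2 ℤ.* x ℤ.+ + 1) ℤ.* (+ 2 ℤ.* x ℤ.+ + 1) ≡ + 4 ℤ.* (x ℤ.* (x ℤ.+ ℤ.1ℤ)) ℤ.+ + 1
    expand = solve-∀
    regroup : ∀ s → + 4 ℤ.* (s ℤ.* + 2) ℤ.+ + 1 ≡ + 8 ℤ.* s ℤ.+ + 1
    regroup = solve-∀

  card-t : ∀ a b c n .{{_ : NonZero a}} .{{_ : NonZero b}} .{{_ : NonZero c}} →
           HasCard (λ p → n ≡ T a b c p) (t a b c n)
  card-t a b c n = card-filter (λ p → n ≟ T a b c p) (box-unique n) λ { {x , y , z} e →
    let p , q , r = summands≤ a b c e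
    in ∈-box (bound x p) (bound y q) (bound z r) }
    where
    bound : ∀ x → tri x ≤ n → ∣ x ∣ ≤ suc n
    bound x tri≤n = ≤-trans (proj₂ (tri*2 x)) (s≤s tri≤n)

  -- Completing the squares: each odd square contributes eight times a triangular number and leaves
  -- its coefficient as a constant.
  Q-odd : ∀ a b c x y z → Q a b c (twice+1 x , twice+1 y , twice+1 z)
                          ≡ + 8 ℤ.* + T a b c (x , y , z) ℤ.+ (+ a ℤ.+ + b ℤ.+ + c)
  Q-odd a b c x y z = begin
    Q a b c (twice+1 x , twice+1 y , twice+1 z)
      ≡⟨ cong₂ ℤ._+_ (cong₂ ℤ._+_ (cong (+ a ℤ.*_) (odd-square x)) (cong (+ b ℤ.*_) (odd-square y)))
                     (cong (+ c ℤ.*_) (odd-square z)) ⟩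
    _ ≡⟨ regroup (+ a) (+ b) (+ c) (+ tri x) (+ tri y) (+ tri z) ⟩
    + 8 ℤ.* (+ a ℤ.* + tri x ℤ.+ + b ℤ.* + tri y ℤ.+ + c ℤ.* + tri z) ℤ.+ (+ a ℤ.+ + b ℤ.+ + c)
      ≡⟨ cong (λ k → + 8 ℤ.* k ℤ.+ (+ a ℤ.+ + b ℤ.+ + c))
           (cong₂ ℤ._+_ (cong₂ ℤ._+_ (ℤ.pos-* a (tri x)) (ℤ.pos-* b (tri y))) (ℤ.pos-* c (tri z))) ⟨
    + 8 ℤ.* + T a b c (x , y , z) ℤ.+ (+ a ℤ.+ + b ℤ.+ + c) ∎
    where
    open ≡-Reasoning
    regroup : ∀ a b c u v w →
      a ℤ.* (+ 8 ℤ.* u ℤ.+ + 1) ℤ.+ b ℤ.* (+ 8 ℤ.* v ℤ.+ + 1) ℤ.+ c ℤ.* (+ 8 ℤ.* w ℤ.+ + 1)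
      ≡ + 8 ℤ.* (a ℤ.* u ℤ.+ b ℤ.* v ℤ.+ c ℤ.* w) ℤ.+ (a ℤ.+ b ℤ.+ c)
    regroup = solve-∀

open Enumeration

-- Solutions of diagonal ternary forms: linear certificates, congruences and quadratic
-- multiplications.

module Forms where

  open import Data.Integer using (_+_; _*_; _-_; -_; 0ℤ)
  open import Data.Integer.Properties using (+-inverseʳ; *-zeroʳ; *-comm; *-cancelˡ-≡; i-j≡0⇒i≡j; abs-*; neg-involutive)

  -- Linear combinations c₁ ⊡ e₁ ⊞ c₂ ⊡ e₂ of equations; the multiplier k clears denominators.

  infixl 7 _⊡_
  infixl 6 _⊞_

  _⊡_ : ∀ {l r} c → l ≡ r → c * (l - r) ≡ 0ℤ
  _⊡_ {l} c refl = trans (cong (c *_) (+-inverseʳ l)) (*-zeroʳ c)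

  _⊞_ : ∀ {x y} → x ≡ 0ℤ → y ≡ 0ℤ → x + y ≡ 0ℤ
  refl ⊞ refl = refl

  by-combination : ∀ {l r d} k .{{_ : ℤ.NonZero k}} → d ≡ 0ℤ → k * (l - r) ≡ d → l ≡ r
  by-combination {l} {r} k d≡0 e =
    i-j≡0⇒i≡j l r (*-cancelˡ-≡ k (l - r) 0ℤ (trans e (trans d≡0 (sym (*-zeroʳ k)))))

  -- The uniform way to refute a congruence: the hypotheses combine to `m * w ≡ c`, while the
  -- decision procedure for divisibility computes that `m` does not divide `c`. The quotient `w` is
  -- supplied by hand.
  indivisible : ∀ {d} k m c w .{{_ : ℤ.NonZero k}} {m∤c : False (∣ m ∣ ∣? ∣ c ∣)} →
                d ≡ 0ℤ → k * (m * w - c) ≡ d → ⊥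
  indivisible k m c w {m∤c} d≡0 e = toWitnessFalse m∤c (divides ∣ w ∣
    (trans (cong ∣_∣ (trans (sym (by-combination k d≡0 e)) (*-comm m w))) (abs-* w m)))

  Even Odd : Pred ℤ 0ℓ
  Even x = ∃ λ k → x ≡ + 2 * k
  Odd  x = ∃ λ k → x ≡ + 2 * k + + 1

  parity : ∀ x → Even x ⊎ Odd x
  parity x = residue (x %ℕ 2) (x /ℕ 2) (a≡a%ℕn+[a/ℕn]*n x 2) (n%ℕd<d x 2)
    where
    residue : ∀ r q → x ≡ + r + q * + 2 → r ℕ.< 2 → Even x ⊎ Odd x
    residue 0 q e _ = inj₁ (q , by-combination (+ 1) (+ 1 ⊡ e) (solve (x ∷ q ∷ [])))
    residue 1 q e _ = inj₂ (q , by-combination (+ 1) (+ 1 ⊡ e) (solve (x ∷ q ∷ [])))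
    residue (ℕ.suc (ℕ.suc _)) _ _ (s≤s (s≤s ()))

  ¬even∧odd : ∀ {x} → Even x → Odd x → ⊥
  ¬even∧odd (k , refl) (l , e) =
    indivisible (+ 1) (+ 2) (+ 1) (k - l) (+ 1 ⊡ e) (solve (k ∷ l ∷ []))

  ¬even⇒odd : ∀ {x} → (Even x → ⊥) → Odd x
  ¬even⇒odd {x} ¬even with parity x
  ... | inj₁ even = ⊥-elim (¬even even)
  ... | inj₂ odd  = odd

  -- Since (2i + 1)² = 4i(i + 1) + 1, the witness is i(i + 1)/2, made explicit by the parity of i.
  odd² : ∀ x → Odd x → ∃ λ j → x * x ≡ + 8 * j + + 1
  odd² _ (i , refl) = go i (parity i)
    where
    go : ∀ i → Even i ⊎ Odd i → ∃ λ j → (+ 2 * i + + 1) * (+ 2 * i + + 1) ≡ + 8 * j + + 1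
    go _ (inj₁ (k , refl)) = k * (+ 2 * k + + 1) , solve (k ∷ [])
    go _ (inj₂ (k , refl)) = (k + + 1) * (+ 2 * k + + 1) , solve (k ∷ [])

  odd-neg : ∀ {x} → Odd x → Odd (- x)
  odd-neg (k , refl) = - k - + 1 , solve (k ∷ [])

  -- The odd residues modulo 4 are 1 and -1.
  odds-mod4 : ∀ {x y} → Odd x → Odd y → (∃ λ s → x ≡ y + + 4 * s) ⊎ (∃ λ s → x ≡ - y + + 4 * s)
  odds-mod4 {x} {y} (i , refl) (j , refl) = Sum.map even odd (parity (i - j))
    where
    even : Even (i - j) → ∃ λ s → + 2 * i + + 1 ≡ + 2 * j + + 1 + + 4 * s
    even (s , e) = s , by-combination (+ 1) (+ 2 ⊡ e) (solve (i ∷ j ∷ s ∷ []))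
    odd : Odd (i - j) → ∃ λ s → + 2 * i + + 1 ≡ - (+ 2 * j + + 1) + + 4 * s
    odd (s , e) = s + j + + 1 , by-combination (+ 1) (+ 2 ⊡ e) (solve (i ∷ j ∷ s ∷ []))

  -- Triples, solution sets and their symmetries.

  ℤ³ : Set
  ℤ³ = ℤ × ℤ × ℤ

  triple≡ : ∀ {x x′ y y′ z z′ : ℤ} → x ≡ x′ → y ≡ y′ → z ≡ z′ →
            _≡_ {A = ℤ³} (x , y , z) (x′ , y′ , z′)
  triple≡ refl refl refl = refl

  triple-injective : ∀ {x x′ y y′ z z′ : ℤ} → _≡_ {A = ℤ³} (x , y , z) (x′ , y′ , z′) →
                     x ≡ x′ × y ≡ y′ × z ≡ z′
  triple-injective refl = refl , refl , refl

  -- An inductive family, so that unification recovers coefficients and coordinates, which an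
  -- unfolded equation would not determine.
  data Sol (a b c m : ℤ) : Pred ℤ³ 0ℓ where
    sol : ∀ {x y z} → m ≡ a * (x * x) + b * (y * y) + c * (z * z) → Sol a b c m (x , y , z)

  Odd³ : Pred ℤ³ 0ℓ
  Odd³ (x , y , z) = Odd x × Odd y × Odd z

  OddSol : ℤ → ℤ → ℤ → ℤ → Pred ℤ³ 0ℓ
  OddSol a b c m p = Odd³ p × Sol a b c m p

  swap₂₃ swap₁₃ conj : ℤ³ → ℤ³
  swap₂₃ (x , y , z) = x , z , y
  swap₁₃ (x , y , z) = z , y , x
  conj   (x , y , z) = x , - y , z

  Sol-swap₂₃ : ∀ {a b c m p} → Sol a b c m p → Sol a c b m (swap₂₃ p)
  Sol-swap₂₃ {a} {b} {c} (sol {x} {y} {z} e) = sol (trans e (solve (a ∷ b ∷ c ∷ x ∷ y ∷ z ∷ [])))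

  Sol-swap₁₃ : ∀ {a b c m p} → Sol a b c m p → Sol c b a m (swap₁₃ p)
  Sol-swap₁₃ {a} {b} {c} (sol {x} {y} {z} e) = sol (trans e (solve (a ∷ b ∷ c ∷ x ∷ y ∷ z ∷ [])))

  Sol-conj : ∀ {a b c m p} → Sol a b c m p → Sol a b c m (conj p)
  Sol-conj {a} {b} {c} (sol {x} {y} {z} e) = sol (trans e (solve (a ∷ b ∷ c ∷ x ∷ y ∷ z ∷ [])))

  OddSol-conj : ∀ {a b c m p} → OddSol a b c m p → OddSol a b c m (conj p)
  OddSol-conj ((ox , oy , oz) , s) = (ox , odd-neg oy , oz) , Sol-conj s

  conj-involutive : ∀ p → conj (conj p) ≡ p
  conj-involutive (x , y , z) = triple≡ refl (neg-involutive y) refl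

  module _ {a b c m : ℤ} {k : ℕ} where

    card-Sol-swap₂₃ : HasCard (Sol a b c m) k → HasCard (Sol a c b m) k
    card-Sol-swap₂₃ = card-involution swap₂₃ (λ _ → refl) Sol-swap₂₃ Sol-swap₂₃

    card-Sol-swap₁₃ : HasCard (Sol a b c m) k → HasCard (Sol c b a m) k
    card-Sol-swap₁₃ = card-involution swap₁₃ (λ _ → refl) Sol-swap₁₃ Sol-swap₁₃

    card-OddSol-swap₂₃ : HasCard (OddSol a b c m) k → HasCard (OddSol a c b m) k
    card-OddSol-swap₂₃ = card-involution swap₂₃ (λ _ → refl)
      (λ { ((ox , oy , oz) , s) → (ox , oz , oy) , Sol-swap₂₃ s })
      (λ { ((ox , oy , oz) , s) → (ox , oz , oy) , Sol-swap₂₃ s })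

    card-OddSol-swap₁₃ : HasCard (OddSol a b c m) k → HasCard (OddSol c b a m) k
    card-OddSol-swap₁₃ = card-involution swap₁₃ (λ _ → refl)
      (λ { ((ox , oy , oz) , s) → (oz , oy , ox) , Sol-swap₁₃ s })
      (λ { ((ox , oy , oz) , s) → (oz , oy , ox) , Sol-swap₁₃ s })

  -- 3(X − 5Y)(X + 5Y) = 3X² + 5Y² − 80Y² is divisible by 16, while (X − 5Y)/2 and (X + 5Y)/2
  -- have opposite parities; hence one of these two is divisible by 4.
  module _ where

    private
      half : ∀ i j {X Y m} → X ≡ + 2 * i + + 1 → Y ≡ + 2 * j + + 1 →
             + 3 * (X * X) + + 5 * (Y * Y) ≡ + 16 * m →
             (∃ λ s → (i + + 5 * j + + 3) * (i + + 5 * j + + 3) ≡ + 8 * s + + 1) →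
             ∃ λ v → X ≡ + 8 * v + + 5 * Y
      half i j {m = m} refl refl e (s , eu) =
        -- Here `u` is (X + 5Y)/2 and `v` is (X - 5Y)/2, so `e` says 3uv = 4w. As u² = 8s + 1,
        -- multiplying by u gives 3v = 4wu - 24sv, and v = 4v - 3v is four times the witness.
        let u = i + + 5 * j + + 3
            v = i - + 5 * j - + 2
            w = m - + 5 * ((+ 2 * j + + 1) * (+ 2 * j + + 1))
        in v - w * u + + 6 * s * v
         , by-combination (+ 2) (- u ⊡ e ⊞ + 12 * v ⊡ eu) (solve (i ∷ j ∷ m ∷ s ∷ []))

    x≡±5y-mod8 : ∀ {X Y} → Odd X → Odd Y → (∃ λ m → + 3 * (X * X) + + 5 * (Y * Y) ≡ + 16 * m) →
                 (∃ λ v → X ≡ + 8 * v + + 5 * Y) ⊎ (∃ λ v → X ≡ + 8 * v + + 5 * (- Y))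
    x≡±5y-mod8 {X} {Y} (i , refl) (j , refl) (m , e) = choose (parity (i + + 5 * j + + 3))
      where
      choose : Even (i + + 5 * j + + 3) ⊎ Odd (i + + 5 * j + + 3) →
               (∃ λ v → X ≡ + 8 * v + + 5 * Y) ⊎ (∃ λ v → X ≡ + 8 * v + + 5 * (- Y))
      choose (inj₂ ou)      = inj₁ (half i j refl refl e (odd² (i + + 5 * j + + 3) ou))
      -- Replacing j by -j - 1 negates Y and interchanges the two halves; they differ by the odd
      -- number 5Y, so the one now playing the role of u is odd.
      choose (inj₁ (s , f)) = inj₂ (half i (- j - + 1) {+ 2 * i + + 1} {Y = - (+ 2 * j + + 1)} {m} refl
        (solve (j ∷ [])) (by-combination (+ 1) (+ 1 ⊡ e) (solve (i ∷ j ∷ m ∷ [])))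
        (odd² (i + + 5 * (- j - + 1) + + 3) (s - + 5 * j - + 3 , by-combination (+ 1) (+ 1 ⊡ f) (solve (i ∷ j ∷ s ∷ [])))))

  -- Multiplication by (1 ± √-15)/2, of norm 4, acts on 3x² + 5y² = N(3x + y√-15)/3; Twist applies this
  -- multiplication, Lift twice the multiplication.
  module Lift (d q : ℤ) (od : Odd d) where

    private
      f : ℤ³ → ℤ³
      f (x , y , z) = x + + 5 * y , y - + 3 * x , z

      f-injective : ∀ {p p′} → f p ≡ f p′ → p ≡ p′
      f-injective {x , y , z} {x′ , y′ , z′} e = solve-f (triple-injective e)
        where
        solve-f : x + + 5 * y ≡ x′ + + 5 * y′ × y - + 3 * x ≡ y′ - + 3 * x′ × z ≡ z′ →
                  (x , y , z) ≡ (x′ , y′ , z′)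
        solve-f (e₁ , e₂ , e₃) = triple≡
          (by-combination (+ 16) (+ 1 ⊡ e₁ ⊞ - + 5 ⊡ e₂) (solve (x ∷ y ∷ x′ ∷ y′ ∷ [])))
          (by-combination (+ 16) (+ 3 ⊡ e₁ ⊞ + 1 ⊡ e₂) (solve (x ∷ y ∷ x′ ∷ y′ ∷ [])))
          e₃

      S = Sol (+ 12) (+ 20) d (d + + 8 * q + + 4)
      O = OddSol (+ 3) (+ 5) (+ 4 * d) (+ 4 * (d + + 8 * q + + 4))

      odd-z : ∀ {x y z} → S (x , y , z) → Odd z
      odd-z (sol {x} {y} {z} e) = ¬even⇒odd λ ez → even {d} {x} {y} {z} od ez e
        where
        even : ∀ {d x y z} → Odd d → Even z →
               d + + 8 * q + + 4 ≡ + 12 * (x * x) + + 20 * (y * y) + d * (z * z) → ⊥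
        even {x = x} {y} (k , refl) (i , refl) e = indivisible (+ 1) (+ 2) (+ 1)
          (+ 6 * (x * x) + + 10 * (y * y) + (+ 2 * k + + 1) * (+ 2 * (i * i)) - k - + 4 * q - + 2)
          (- + 1 ⊡ e) (solve (x ∷ y ∷ i ∷ k ∷ q ∷ []))

      -- As z is odd, d z² ≡ d modulo 8; the equation then gives 4(3x² + 5y²) ≡ 4 modulo 8, so 3x² +
      -- 5y² is odd.
      odd-x+y : ∀ {x y z} → S (x , y , z) → Odd (x + y)
      odd-x+y s@(sol {x} {y} {z} e) = ¬even⇒odd λ even → impossible even (odd² z (odd-z s))
        where
        impossible : Even (x + y) → (∃ λ j → z * z ≡ + 8 * j + + 1) → ⊥
        impossible (s , f) (j , ez) = indivisible (+ 4) (+ 2) (+ 1)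
          (+ 4 * (x * x) - + 10 * (s * x) + + 10 * (s * s) + d * j - q)
          (- + 1 ⊡ e ⊞ - d ⊡ ez ⊞ - + 20 * (y - x + + 2 * s) ⊡ f)
          (solve (x ∷ y ∷ z ∷ s ∷ j ∷ q ∷ d ∷ []))

      f-sound : ∀ {p} → S p → O (f p)
      f-sound s@(sol {x} {y} {z} e) = (odd-X (odd-x+y s) , odd-Y (odd-x+y s) , odd-z s) ,
        sol (by-combination (+ 1) (+ 4 ⊡ e) (solve (x ∷ y ∷ z ∷ q ∷ d ∷ [])))
        where
        odd-X : Odd (x + y) → Odd (x + + 5 * y)
        odd-X (k , e) = k + + 2 * y , by-combination (+ 1) (+ 1 ⊡ e) (solve (x ∷ y ∷ k ∷ []))
        odd-Y : Odd (x + y) → Odd (y - + 3 * x)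
        odd-Y (k , e) = k - + 2 * x , by-combination (+ 1) (+ 1 ⊡ e) (solve (x ∷ y ∷ k ∷ []))

      preimage : ∀ {X Y Z} → O (X , Y , Z) → (∃ λ v → X ≡ + 8 * v + + 5 * Y) → Image f S (X , Y , Z)
      preimage ((_ , oy , oz) , sol {X} {Y} {Z} e) (v , h) = halve oy (odd² Z oz) (parity v)
        where
        halve : Odd Y → (∃ λ j → Z * Z ≡ + 8 * j + + 1) → Even v ⊎ Odd v → Image f S (X , Y , Z)
        -- Inverting `f` gives 16x = X - 5Y = 8v, so x has to be v/2.
        halve _ _ (inj₁ (w , ev)) = (w , Y + + 3 * w , Z)
          , sol (by-combination (+ 4) (+ 1 ⊡ e ⊞ + 3 * (X + + 16 * w + + 5 * Y) ⊡ h
                                       ⊞ + 24 * (X + + 16 * w + + 5 * Y) ⊡ ev)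
                  (solve (X ∷ Y ∷ Z ∷ v ∷ w ∷ q ∷ d ∷ [])))
          , triple≡ (by-combination (+ 1) (- + 1 ⊡ h ⊞ - + 8 ⊡ ev) (solve (X ∷ Y ∷ v ∷ w ∷ [])))
                    (solve (Y ∷ w ∷ [])) refl
        -- The equation makes (3X² + 5Y²)/16 = 12v² + 15vY + 5Y² odd, but it is even when v and Y
        -- are both odd.
        halve (i , ey) (j , ez) (inj₂ (w , ev)) = ⊥-elim (indivisible (+ 16) (+ 2) (+ 1)
          (+ 6 * (v * v) + + 5 * (Y * (+ 3 * w + i + + 2)) - q + d * j)
          (- + 1 ⊡ e ⊞ - + 4 * d ⊡ ez ⊞ - + 3 * (X + + 8 * v + + 5 * Y) ⊡ h
           ⊞ - + 240 * Y ⊡ ev ⊞ - + 80 * Y ⊡ ey)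
          (solve (X ∷ Y ∷ Z ∷ v ∷ w ∷ i ∷ j ∷ q ∷ d ∷ [])))

      onto : ∀ {p} → O p → Image f S p ⊎ Image f S (conj p)
      onto o@((ox , oy , oz) , sol {X} {Y} {Z} e) =
        Sum.map (preimage o) (preimage (OddSol-conj o)) (x≡±5y-mod8 ox oy (split (odd² Z oz)))
        where
        split : (∃ λ j → Z * Z ≡ + 8 * j + + 1) → ∃ λ r → + 3 * (X * X) + + 5 * (Y * Y) ≡ + 16 * r
        split (j , ez) = + 2 * q + + 1 - + 2 * d * j
          , by-combination (+ 1) (- + 1 ⊡ e ⊞ - + 4 * d ⊡ ez) (solve (X ∷ Y ∷ Z ∷ j ∷ q ∷ d ∷ []))

      -- A common image would satisfy X - 5Y = 16x and X + 5Y = 16x′, so 16 would divide 10Y with Y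
      -- odd.
      apart : ∀ {p p′} → S p → S p′ → f p ≢ conj (f (conj p′))
      apart {x , y , z} {x′ , y′ , z′} s s′ g = clash (triple-injective g) (proj₁ (proj₂ (proj₁ (f-sound s))))
        where
        clash : x + + 5 * y ≡ x′ + + 5 * (- y′) × y - + 3 * x ≡ - (- y′ - + 3 * x′) × z ≡ z′ →
                Odd (y - + 3 * x) → ⊥
        clash (g₁ , g₂ , _) (k , o) = indivisible (+ 1) (+ 4) (+ 10) (+ 4 * (x′ - x) - + 5 * k)
          (- + 1 ⊡ g₁ ⊞ - + 5 ⊡ g₂ ⊞ + 10 ⊡ o) (solve (x ∷ y ∷ x′ ∷ y′ ∷ k ∷ []))

    card-double-lift : ∀ {k} → HasCard S k → HasCard O (k ℕ.+ k)
    card-double-lift = card-double-conjugate conj f conj-involutive f-injective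
                         Sol-conj OddSol-conj f-sound onto apart

  module Twist (d q : ℤ) where

    private
      S = OddSol (+ 3) (+ 5) d (d + + 8 * q + + 8)
      O = OddSol (+ 3) (+ 5) (+ 4 * d) (+ 4 * (d + + 8 * q + + 8))

      -- Multiplication of 3x + y√-15 by (1 - √-15)/2, written without division.
      data _⇝_ : ℤ³ → ℤ³ → Set where
        link : ∀ {x y z X Y} → + 2 * X ≡ x + + 5 * y → + 2 * Y ≡ y - + 3 * x → (x , y , z) ⇝ (X , Y , z)

      -- The second alternative multiplies by the conjugate number. From an odd solution exactly one
      -- of the two leads to odd coordinates.
      _∼_ : ℤ³ → ℤ³ → Set
      p ∼ p′ = p ⇝ p′ ⊎ conj p ⇝ conj p′

      mirror : ∀ {p b} → conj p ⇝ b → p ∼ conj b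
      mirror {p} {b} l = inj₂ (subst (conj p ⇝_) (sym (conj-involutive b)) l)

      -- The congruence x ≡ y modulo 4 makes (x + 5y)/2 and (y - 3x)/2 odd; for x ≡ -y they would be
      -- even, and `total` conjugates first.
      total⁺ : ∀ {x y z} → S (x , y , z) → (∃ λ s → x ≡ y + + 4 * s) → ∃ λ b → O b × (x , y , z) ⇝ b
      total⁺ ((_ , oy , oz) , sol {x} {y} {z} e) (s , h) = (+ 3 * y + + 2 * s , - y - + 6 * s , z)
        , ((odd-X oy , odd-Y oy , oz)
          , sol (by-combination (+ 1) (+ 4 ⊡ e ⊞ + 12 * (x + y + + 4 * s) ⊡ h)
                   (solve (x ∷ y ∷ z ∷ s ∷ q ∷ d ∷ []))))
        , link (by-combination (+ 1) (- + 1 ⊡ h) (solve (x ∷ y ∷ s ∷ [])))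
               (by-combination (+ 1) (+ 3 ⊡ h) (solve (x ∷ y ∷ s ∷ [])))
        where
        odd-X : Odd y → Odd (+ 3 * y + + 2 * s)
        odd-X (k , f) = + 3 * k + s + + 1 , by-combination (+ 1) (+ 3 ⊡ f) (solve (y ∷ s ∷ k ∷ []))
        odd-Y : Odd y → Odd (- y - + 6 * s)
        odd-Y (k , f) = - k - + 3 * s - + 1 , by-combination (+ 1) (- + 1 ⊡ f) (solve (y ∷ s ∷ k ∷ []))

      total : ∀ {p} → S p → ∃ λ b → O b × p ∼ b
      total {x , y , z} s@((ox , oy , oz) , _) = choose (odds-mod4 ox oy)
        where
        choose : (∃ λ s → x ≡ y + + 4 * s) ⊎ (∃ λ s → x ≡ - y + + 4 * s) → ∃ λ b → O b × (x , y , z) ∼ b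
        choose (inj₁ h) = let b , o , l = total⁺ s h in b , o , inj₁ l
        choose (inj₂ h) = let b , o , l = total⁺ (OddSol-conj s) h in conj b , OddSol-conj o , mirror l

      cototal⁺ : ∀ {X Y Z} → O (X , Y , Z) → (∃ λ v → X ≡ + 8 * v + + 5 * Y) →
                 ∃ λ p → S p × p ⇝ (X , Y , Z)
      -- Inverting the link gives 8x = X - 5Y = 8v, so x = v.
      cototal⁺ ((_ , oy , oz) , sol {X} {Y} {Z} e) (v , h) = (v , + 2 * Y + + 3 * v , Z)
        , ((odd-v , odd-y odd-v , oz)
          , sol (by-combination (+ 4) (+ 1 ⊡ e ⊞ + 3 * (X + + 8 * v + + 5 * Y) ⊡ h)
                   (solve (X ∷ Y ∷ Z ∷ v ∷ q ∷ d ∷ []))))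
        , link (by-combination (+ 1) (+ 2 ⊡ h) (solve (X ∷ Y ∷ v ∷ [])))
               (solve (Y ∷ v ∷ []))
        where
        even-impossible : Odd Y → (∃ λ j → Z * Z ≡ + 8 * j + + 1) → Even v → ⊥
        -- In contrast to `Lift`, the number 12v² + 15vY + 5Y² is now even by the equation, which an
        -- even v and an odd Y contradict.
        even-impossible (i , ey) (j , ez) (w , ev) = indivisible (+ 16) (+ 2) (+ 1)
          (q - d * j - (+ 12 * (v * w) + + 15 * (w * Y) + + 5 * (Y * i) + + 5 * i + + 1))
          (+ 1 ⊡ e ⊞ + 4 * d ⊡ ez ⊞ + 3 * (X + + 8 * v + + 5 * Y) ⊡ h
           ⊞ (+ 192 * v + + 240 * Y) ⊡ ev ⊞ (+ 80 * Y + + 80) ⊡ ey)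
          (solve (X ∷ Y ∷ Z ∷ v ∷ w ∷ i ∷ j ∷ q ∷ d ∷ []))
        odd-v : Odd v
        odd-v = ¬even⇒odd (even-impossible oy (odd² Z oz))
        odd-y : Odd v → Odd (+ 2 * Y + + 3 * v)
        odd-y (k , f) = Y + + 3 * k + + 1 , by-combination (+ 1) (+ 3 ⊡ f) (solve (Y ∷ v ∷ k ∷ []))

      cototal : ∀ {b} → O b → ∃ λ p → S p × p ∼ b
      cototal o@((oX , oY , oZ) , sol {X} {Y} {Z} e) = choose (x≡±5y-mod8 oX oY (split (odd² Z oZ)))
        where
        split : (∃ λ j → Z * Z ≡ + 8 * j + + 1) → ∃ λ r → + 3 * (X * X) + + 5 * (Y * Y) ≡ + 16 * r
        split (j , ez) = + 2 * q + + 2 - + 2 * d * j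
          , by-combination (+ 1) (- + 1 ⊡ e ⊞ - + 4 * d ⊡ ez) (solve (X ∷ Y ∷ Z ∷ j ∷ q ∷ d ∷ []))
        choose : (∃ λ v → X ≡ + 8 * v + + 5 * Y) ⊎ (∃ λ v → X ≡ + 8 * v + + 5 * (- Y)) →
                 ∃ λ p → S p × p ∼ (X , Y , Z)
        choose (inj₁ h) = let p , s , l = cototal⁺ o h in p , s , inj₁ l
        choose (inj₂ h) = let p , s , l = cototal⁺ (OddSol-conj o) h in
          conj p , OddSol-conj s , inj₂ (subst (_⇝ conj (X , Y , Z)) (sym (conj-involutive p)) l)

      equations : ∀ {x y z X Y Z} → (x , y , z) ⇝ (X , Y , Z) →
                  + 2 * X ≡ x + + 5 * y × + 2 * Y ≡ y - + 3 * x × z ≡ Z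
      equations (link e₁ e₂) = e₁ , e₂ , refl

      functional⁺ : ∀ {p b b′} → p ⇝ b → p ⇝ b′ → b ≡ b′
      functional⁺ (link {x} {y} {z} {X} {Y} e₁ e₂) (link {X = X′} {Y′} e₁′ e₂′) = triple≡
        (by-combination (+ 2) (+ 1 ⊡ e₁ ⊞ - + 1 ⊡ e₁′) (solve (x ∷ y ∷ X ∷ X′ ∷ [])))
        (by-combination (+ 2) (+ 1 ⊡ e₂ ⊞ - + 1 ⊡ e₂′) (solve (x ∷ y ∷ Y ∷ Y′ ∷ [])))
        refl

      injective⁺ : ∀ {p p′ b} → p ⇝ b → p′ ⇝ b → p ≡ p′
      injective⁺ (link {x} {y} {z} {X} {Y} e₁ e₂) (link {x′} {y′} e₁′ e₂′) = triple≡
        (by-combination (+ 16) (- + 1 ⊡ e₁ ⊞ + 1 ⊡ e₁′ ⊞ + 5 ⊡ e₂ ⊞ - + 5 ⊡ e₂′)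
          (solve (x ∷ y ∷ x′ ∷ y′ ∷ X ∷ Y ∷ [])))
        (by-combination (+ 16) (- + 3 ⊡ e₁ ⊞ + 3 ⊡ e₁′ ⊞ - + 1 ⊡ e₂ ⊞ + 1 ⊡ e₂′)
          (solve (x ∷ y ∷ x′ ∷ y′ ∷ X ∷ Y ∷ [])))
        refl

      conj-injective : ∀ {p p′} → conj p ≡ conj p′ → p ≡ p′
      conj-injective {p} {p′} e = trans (sym (conj-involutive p)) (trans (cong conj e) (conj-involutive p′))

      -- Adding the second equations of the two links gives Y - Y′ = -3x, where the left side is
      -- even and the right side odd.
      images-apart : ∀ {p b b′} → S p → O b → O b′ → p ⇝ b → conj p ⇝ conj b′ → ⊥
      images-apart {x , y , z} {X , Y , Z} {X′ , Y′ , Z′} ((ox , _) , _) ((_ , oY , _) , _) ((_ , oY′ , _) , _) l l′ =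
        clash ox oY oY′ (equations l) (equations l′)
        where
        clash : Odd x → Odd Y → Odd Y′ → + 2 * X ≡ x + + 5 * y × + 2 * Y ≡ y - + 3 * x × z ≡ Z →
                + 2 * X′ ≡ x + + 5 * (- y) × + 2 * (- Y′) ≡ - y - + 3 * x × z ≡ Z′ → ⊥
        clash (i , o) (k , oY) (k′ , oY′) (_ , e , _) (_ , e′ , _) =
          indivisible (+ 1) (+ 4) (+ 6) (k′ - k - + 3 * i)
            (- + 1 ⊡ e′ ⊞ - + 1 ⊡ e ⊞ - + 2 ⊡ oY′ ⊞ + 2 ⊡ oY ⊞ + 6 ⊡ o)
            (solve (x ∷ y ∷ Y ∷ Y′ ∷ i ∷ k ∷ k′ ∷ []))

      -- The links give X - 5Y = 8x and X + 5Y = 8x′, so 8 would divide 10Y with Y odd.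
      sources-apart : ∀ {p p′ b} → O b → p ⇝ b → conj p′ ⇝ conj b → ⊥
      sources-apart {x , y , z} {x′ , y′ , z′} {X , Y , Z} ((_ , oY , _) , _) l l′ =
        clash oY (equations l) (equations l′)
        where
        clash : Odd Y → + 2 * X ≡ x + + 5 * y × + 2 * Y ≡ y - + 3 * x × z ≡ Z →
                + 2 * X ≡ x′ + + 5 * (- y′) × + 2 * (- Y) ≡ - y′ - + 3 * x′ × z′ ≡ Z → ⊥
        clash (k , o) (e₁ , e₂ , _) (e₁′ , e₂′ , _) =
          indivisible (+ 1) (+ 8) (+ 20) (+ 2 * (x′ - x) - + 5 * k)
            (- + 1 ⊡ e₁′ ⊞ + 5 ⊡ e₂′ ⊞ + 1 ⊡ e₁ ⊞ - + 5 ⊡ e₂ ⊞ + 20 ⊡ o)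
            (solve (x ∷ y ∷ x′ ∷ y′ ∷ X ∷ Y ∷ k ∷ []))

      functional : ∀ {p b b′} → S p → O b → O b′ → p ∼ b → p ∼ b′ → b ≡ b′
      functional _ _ _  (inj₁ l) (inj₁ l′) = functional⁺ l l′
      functional _ _ _  (inj₂ l) (inj₂ l′) = conj-injective (functional⁺ l l′)
      functional s o o′ (inj₁ l) (inj₂ l′) = ⊥-elim (images-apart s o o′ l l′)
      functional s o o′ (inj₂ l) (inj₁ l′) = ⊥-elim (images-apart s o′ o l′ l)

      injective : ∀ {p p′ b} → S p → S p′ → O b → p ∼ b → p′ ∼ b → p ≡ p′
      injective _ _ _ (inj₁ l) (inj₁ l′) = injective⁺ l l′
      injective _ _ _ (inj₂ l) (inj₂ l′) = conj-injective (injective⁺ l l′)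
      injective _ _ o (inj₁ l) (inj₂ l′) = ⊥-elim (sources-apart o l l′)
      injective _ _ o (inj₂ l) (inj₁ l′) = ⊥-elim (sources-apart o l′ l)

    card-twist : ∀ {k} → HasCard S k → HasCard O k
    card-twist = card-matching record
      { total = total ; cototal = cototal ; functional = functional ; injective = injective }

  -- Multiplication by 1 ± √-3 on x² + 3y².
  module Eisenstein (e q : ℤ) (odd-e : Odd e) where

    private
      S = Sol (+ 4 * e) (+ 12 * e) (+ 5) (+ 8 * q + + 4 * e + + 5)
      O = OddSol e (+ 3 * e) (+ 5) (+ 8 * q + + 4 * e + + 5)

      f : ℤ³ → ℤ³
      f (x , y , z) = x - + 3 * y , y + x , z

      f-injective : ∀ {p p′} → f p ≡ f p′ → p ≡ p′
      f-injective {x , y , z} {x′ , y′ , z′} g = solve-f (triple-injective g)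
        where
        solve-f : x - + 3 * y ≡ x′ - + 3 * y′ × y + x ≡ y′ + x′ × z ≡ z′ →
                  (x , y , z) ≡ (x′ , y′ , z′)
        solve-f (g₁ , g₂ , g₃) = triple≡
          (by-combination (+ 4) (+ 1 ⊡ g₁ ⊞ + 3 ⊡ g₂) (solve (x ∷ y ∷ x′ ∷ y′ ∷ [])))
          (by-combination (+ 4) (- + 1 ⊡ g₁ ⊞ + 1 ⊡ g₂) (solve (x ∷ y ∷ x′ ∷ y′ ∷ [])))
          g₃

      odd-z : ∀ {x y z} → S (x , y , z) → Odd z
      odd-z (sol {x} {y} {z} h) = ¬even⇒odd even
        where
        even : Even z → ⊥
        even (i , ez) = indivisible (+ 1) (+ 4) (+ 5)
          (e * (x * x) + + 3 * (e * (y * y)) + + 5 * (i * i) - + 2 * q - e)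
          (- + 1 ⊡ h ⊞ - + 5 * (z + + 2 * i) ⊡ ez) (solve (x ∷ y ∷ z ∷ i ∷ e ∷ q ∷ []))

      -- As 5z² ≡ 5 modulo 8, what remains is 4e(x² + 3y²) ≡ 4e modulo 8 with e odd, so x² + 3y² is
      -- odd.
      odd-x+y : ∀ {x y z} → S (x , y , z) → Odd (x + y)
      odd-x+y t@(sol {x} {y} {z} h) = ¬even⇒odd λ even → impossible odd-e even (odd² z (odd-z t))
        where
        impossible : Odd e → Even (x + y) → (∃ λ j → z * z ≡ + 8 * j + + 1) → ⊥
        impossible (k , oe) (s , g) (j , ez) = indivisible (+ 4) (+ 2) (+ 1)
          (e * (+ 2 * (x * x) - + 6 * (s * x) + + 6 * (s * s)) + + 5 * j - q - k)
          (- + 1 ⊡ h ⊞ - + 5 ⊡ ez ⊞ - + 12 * e * (y - x + + 2 * s) ⊡ g ⊞ + 4 ⊡ oe)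
          (solve (x ∷ y ∷ z ∷ s ∷ j ∷ k ∷ e ∷ q ∷ []))

      f-sound : ∀ {p} → S p → O (f p)
      f-sound t@(sol {x} {y} {z} h) = (odd-X (odd-x+y t) , odd-Y (odd-x+y t) , odd-z t) ,
        sol (by-combination (+ 1) (+ 1 ⊡ h) (solve (x ∷ y ∷ z ∷ e ∷ q ∷ [])))
        where
        odd-X : Odd (x + y) → Odd (x - + 3 * y)
        odd-X (k , o) = k - + 2 * y , by-combination (+ 1) (+ 1 ⊡ o) (solve (x ∷ y ∷ k ∷ []))
        odd-Y : Odd (x + y) → Odd (y + x)
        odd-Y (k , o) = k , by-combination (+ 1) (+ 1 ⊡ o) (solve (x ∷ y ∷ k ∷ []))

      preimage : ∀ {X Y Z} → O (X , Y , Z) → (∃ λ s → X ≡ Y + + 4 * s) → Image f S (X , Y , Z)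
      preimage (_ , sol {X} {Y} {Z} h) (s , g) = (Y + s , - s , Z)
        , sol (by-combination (+ 1) (+ 1 ⊡ h ⊞ e * (X + Y + + 4 * s) ⊡ g)
                 (solve (X ∷ Y ∷ Z ∷ s ∷ e ∷ q ∷ [])))
        , triple≡ (by-combination (+ 1) (- + 1 ⊡ g) (solve (X ∷ Y ∷ s ∷ [])))
                  (solve (Y ∷ s ∷ [])) refl

      onto : ∀ {p} → O p → Image f S p ⊎ Image f S (conj p)
      onto {X , Y , Z} o@((oX , oY , _) , _) =
        Sum.map (preimage o) (preimage (OddSol-conj o)) (odds-mod4 oX oY)

      -- A common image would satisfy X - Y = -4y and X + Y = 4y′, making X even.
      apart : ∀ {p p′} → S p → S p′ → f p ≢ conj (f (conj p′))
      apart {x , y , z} {x′ , y′ , z′} t t′ g = clash (triple-injective g) (proj₁ (proj₁ (f-sound t)))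
        where
        clash : x - + 3 * y ≡ x′ - + 3 * (- y′) × y + x ≡ - (- y′ + x′) × z ≡ z′ →
                Odd (x - + 3 * y) → ⊥
        clash (g₁ , g₂ , _) (k , o) = indivisible (+ 1) (+ 4) (+ 2) (y′ - y - k)
          (- + 1 ⊡ g₁ ⊞ - + 1 ⊡ g₂ ⊞ + 2 ⊡ o) (solve (x ∷ y ∷ x′ ∷ y′ ∷ k ∷ []))

    card-double-eisenstein : ∀ {k} → HasCard S k → HasCard O (k ℕ.+ k)
    card-double-eisenstein = card-double-conjugate conj f conj-involutive f-injective
                               Sol-conj OddSol-conj f-sound onto apart

  -- If x were odd, 3x² + 5y² would be 3 or 0 modulo 4 instead of 1; so x is even, and halving it
  -- turns the coefficient 3 into 12.
  card-halve-x : ∀ c r {k} → HasCard (Sol (+ 12) (+ 5) (+ 4 * c) (+ 4 * r + + 1)) k →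
                 HasCard (Sol (+ 3) (+ 5) (+ 4 * c) (+ 4 * r + + 1)) k
  card-halve-x c r = card-map f f-injective f-sound onto
    where
    S = Sol (+ 12) (+ 5) (+ 4 * c) (+ 4 * r + + 1)
    O = Sol (+ 3) (+ 5) (+ 4 * c) (+ 4 * r + + 1)

    f : ℤ³ → ℤ³
    f (x , y , z) = + 2 * x , y , z

    f-injective : ∀ {p p′} → f p ≡ f p′ → p ≡ p′
    f-injective {x , y , z} {x′ , y′ , z′} g = let g₁ , g₂ , g₃ = triple-injective g in
      triple≡ (*-cancelˡ-≡ (+ 2) x x′ g₁) g₂ g₃

    f-sound : ∀ {p} → S p → O (f p)
    f-sound (sol {x} {y} {z} h) =
      sol (by-combination (+ 1) (+ 1 ⊡ h) (solve (x ∷ y ∷ z ∷ c ∷ r ∷ [])))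

    onto : ∀ {p} → O p → Image f S p
    onto (sol {x} {y} {z} h) = cases (parity x) (parity y)
      where
      cases : Even x ⊎ Odd x → Even y ⊎ Odd y → Image f S (x , y , z)
      cases (inj₁ (i , ex)) _ = (i , y , z)
        , sol (by-combination (+ 1) (+ 1 ⊡ h ⊞ + 3 * (x + + 2 * i) ⊡ ex) (solve (x ∷ y ∷ z ∷ i ∷ c ∷ r ∷ [])))
        , triple≡ (sym ex) refl refl
      cases (inj₂ (i , ex)) (inj₁ (j , ey)) = ⊥-elim (indivisible (+ 1) (+ 4) (+ 2)
        (r - + 3 * (i * i + i) - + 5 * (j * j) - c * (z * z))
        (+ 1 ⊡ h ⊞ + 3 * (x + + 2 * i + + 1) ⊡ ex ⊞ + 5 * (y + + 2 * j) ⊡ ey)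
        (solve (x ∷ y ∷ z ∷ i ∷ j ∷ c ∷ r ∷ [])))
      cases (inj₂ (i , ex)) (inj₂ (j , ey)) = ⊥-elim (indivisible (+ 1) (+ 4) (+ 7)
        (r - + 3 * (i * i + i) - + 5 * (j * j + j) - c * (z * z))
        (+ 1 ⊡ h ⊞ + 3 * (x + + 2 * i + + 1) ⊡ ex ⊞ + 5 * (y + + 2 * j + + 1) ⊡ ey)
        (solve (x ∷ y ∷ z ∷ i ∷ j ∷ c ∷ r ∷ [])))

  -- All solutions of 3x² + 5y² + 12z² = 4(8q + 7), split by parity.

  module ThreeFiveTwelve (q : ℤ) where

    private
      S = Sol (+ 12) (+ 20) (+ 3) (+ 8 * q + + 7)
      O = Sol (+ 3) (+ 5) (+ 3) (+ 8 * q + + 7)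

      f g : ℤ³ → ℤ³
      f (x , y , z) = + 2 * x , + 2 * y , z
      g p = swap₁₃ (f p)

      f-injective : ∀ {p p′} → f p ≡ f p′ → p ≡ p′
      f-injective {x , y , z} {x′ , y′ , z′} h = let h₁ , h₂ , h₃ = triple-injective h in
        triple≡ (*-cancelˡ-≡ (+ 2) x x′ h₁) (*-cancelˡ-≡ (+ 2) y y′ h₂) h₃

      f-sound : ∀ {p} → S p → O (f p)
      f-sound (sol {x} {y} {z} h) =
        sol (by-combination (+ 1) (+ 1 ⊡ h) (solve (x ∷ y ∷ z ∷ q ∷ [])))

      odd-z : ∀ {x y z} → S (x , y , z) → Odd z
      odd-z (sol {x} {y} {z} h) = ¬even⇒odd even
        where
        even : Even z → ⊥
        even (i , ez) = indivisible (+ 1) (+ 4) (+ 7)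
          (+ 3 * (x * x) + + 5 * (y * y) + + 3 * (i * i) - + 2 * q)
          (- + 1 ⊡ h ⊞ - + 3 * (z + + 2 * i) ⊡ ez) (solve (x ∷ y ∷ z ∷ i ∷ q ∷ []))

      preimage : ∀ {X Y Z} → O (X , Y , Z) → Even X → Even Y → Image f S (X , Y , Z)
      preimage (sol {X} {Y} {Z} h) (i , ex) (j , ey) = (i , j , Z)
        , sol (by-combination (+ 1) (+ 1 ⊡ h ⊞ + 3 * (X + + 2 * i) ⊡ ex ⊞ + 5 * (Y + + 2 * j) ⊡ ey)
                 (solve (X ∷ Y ∷ Z ∷ i ∷ j ∷ q ∷ [])))
        , triple≡ (sym ex) (sym ey) refl

      -- Here 3X² + 3Z² ≡ 6 modulo 8. An even Y then leaves 2 modulo 4, an odd Y leaves 3 modulo 8,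
      -- and neither agrees with 8q + 7.
      ¬odd-x∧odd-z : ∀ {X Y Z} → O (X , Y , Z) → Odd X → Odd Z → ⊥
      ¬odd-x∧odd-z (sol {X} {Y} {Z} h) oX oZ = cases (odd² X oX) (odd² Z oZ) (parity Y)
        where
        cases : (∃ λ i → X * X ≡ + 8 * i + + 1) → (∃ λ k → Z * Z ≡ + 8 * k + + 1) → Even Y ⊎ Odd Y → ⊥
        cases (i , ex) (k , ez) (inj₁ (j , ey)) = indivisible (+ 1) (+ 4) (+ 1)
          (+ 6 * i + + 6 * k + + 5 * (j * j) - + 2 * q)
          (- + 1 ⊡ h ⊞ - + 3 ⊡ ex ⊞ - + 3 ⊡ ez ⊞ - + 5 * (Y + + 2 * j) ⊡ ey)
          (solve (X ∷ Y ∷ Z ∷ i ∷ j ∷ k ∷ q ∷ []))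
        cases (i , ex) (k , ez) (inj₂ oY) = all-odd (odd² Y oY)
          where
          all-odd : (∃ λ j → Y * Y ≡ + 8 * j + + 1) → ⊥
          all-odd (j , ey) = indivisible (+ 1) (+ 8) (+ 4) (q - + 3 * i - + 3 * k - + 5 * j)
            (+ 1 ⊡ h ⊞ + 3 ⊡ ex ⊞ + 3 ⊡ ez ⊞ + 5 ⊡ ey) (solve (X ∷ Y ∷ Z ∷ i ∷ j ∷ k ∷ q ∷ []))

      ¬even-x∧even-z : ∀ {X Y Z} → O (X , Y , Z) → Even X → Even Z → ⊥
      ¬even-x∧even-z (sol {X} {Y} {Z} h) (i , ex) (k , ez) = cases (parity Y)
        where
        cases : Even Y ⊎ Odd Y → ⊥
        cases (inj₁ (j , ey)) = indivisible (+ 1) (+ 4) (+ 7)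
          (+ 3 * (i * i) + + 5 * (j * j) + + 3 * (k * k) - + 2 * q)
          (- + 1 ⊡ h ⊞ - + 3 * (X + + 2 * i) ⊡ ex ⊞ - + 5 * (Y + + 2 * j) ⊡ ey
           ⊞ - + 3 * (Z + + 2 * k) ⊡ ez) (solve (X ∷ Y ∷ Z ∷ i ∷ j ∷ k ∷ q ∷ []))
        cases (inj₂ (j , ey)) = indivisible (+ 1) (+ 4) (+ 2)
          (+ 3 * (i * i) + + 5 * (j * j + j) + + 3 * (k * k) - + 2 * q)
          (- + 1 ⊡ h ⊞ - + 3 * (X + + 2 * i) ⊡ ex ⊞ - + 5 * (Y + + 2 * j + + 1) ⊡ ey
           ⊞ - + 3 * (Z + + 2 * k) ⊡ ez) (solve (X ∷ Y ∷ Z ∷ i ∷ j ∷ k ∷ q ∷ []))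

      even-y : ∀ {X Y Z} → O (X , Y , Z) → Even X → Odd Z → Even Y
      even-y (sol {X} {Y} {Z} h) (i , ex) (k , ez) = cases (parity Y)
        where
        cases : Even Y ⊎ Odd Y → Even Y
        cases (inj₁ even) = even
        cases (inj₂ (j , ey)) = ⊥-elim (indivisible (+ 1) (+ 4) (- + 1)
          (+ 3 * (i * i) + + 5 * (j * j + j) + + 3 * (k * k + k) - + 2 * q)
          (- + 1 ⊡ h ⊞ - + 3 * (X + + 2 * i) ⊡ ex ⊞ - + 5 * (Y + + 2 * j + + 1) ⊡ ey
           ⊞ - + 3 * (Z + + 2 * k + + 1) ⊡ ez) (solve (X ∷ Y ∷ Z ∷ i ∷ j ∷ k ∷ q ∷ [])))

      onto : ∀ {p} → O p → Image f S p ⊎ Image g S p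
      onto {X , Y , Z} o = cases (parity X) (parity Z)
        where
        cases : Even X ⊎ Odd X → Even Z ⊎ Odd Z → Image f S (X , Y , Z) ⊎ Image g S (X , Y , Z)
        cases (inj₁ ex) (inj₁ ez) = ⊥-elim (¬even-x∧even-z o ex ez)
        cases (inj₂ oX) (inj₂ oZ) = ⊥-elim (¬odd-x∧odd-z o oX oZ)
        cases (inj₁ ex) (inj₂ oZ) = inj₁ (preimage o ex (even-y o ex oZ))
        cases (inj₂ oX) (inj₁ ez) =
          let p , s , h = preimage (Sol-swap₁₃ o) ez (even-y (Sol-swap₁₃ o) ez oX)
          in inj₂ (p , s , cong swap₁₃ h)

      apart : ∀ {p p′} → S p → S p′ → f p ≢ g p′
      apart {x , y , z} {x′ , y′ , z′} s s′ h =
        ¬even∧odd (x , sym (proj₁ (triple-injective h))) (odd-z s′)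

      E = OddSol (+ 3) (+ 5) (+ 12) (+ 4 * (+ 8 * q + + 7))
      W = Sol (+ 3) (+ 5) (+ 12) (+ 4 * (+ 8 * q + + 7))

      -- The same doubling `f`, read with last coefficient 12 in the target: every term is
      -- multiplied by 4.
      f-sound′ : ∀ {p} → O p → W (f p)
      f-sound′ (sol {x} {y} {z} h) =
        sol (by-combination (+ 1) (+ 4 ⊡ h) (solve (x ∷ y ∷ z ∷ q ∷ [])))

      -- Modulo 4 the coordinates x and y have equal parity. If both are odd, 3x² + 5y² ≡ 0 modulo 8
      -- while the right side is 4 modulo 8, which forces z to be odd.
      split : ∀ {p} → W p → E p ⊎ Image f O p
      split w@(sol {x} {y} {z} h) = cases (parity x) (parity y) (parity z)
        where
        cases : Even x ⊎ Odd x → Even y ⊎ Odd y → Even z ⊎ Odd z → E (x , y , z) ⊎ Image f O (x , y , z)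
        cases (inj₁ (i , ex)) (inj₁ (j , ey)) _ = inj₂ ((i , j , z)
          , sol (by-combination (+ 4) (+ 1 ⊡ h ⊞ + 3 * (x + + 2 * i) ⊡ ex ⊞ + 5 * (y + + 2 * j) ⊡ ey)
                   (solve (x ∷ y ∷ z ∷ i ∷ j ∷ q ∷ [])))
          , triple≡ (sym ex) (sym ey) refl)
        cases (inj₁ (i , ex)) (inj₂ (j , ey)) _ = ⊥-elim (indivisible (+ 1) (+ 4) (+ 5)
          (+ 8 * q + + 7 - + 3 * (i * i) - + 5 * (j * j + j) - + 3 * (z * z))
          (+ 1 ⊡ h ⊞ + 3 * (x + + 2 * i) ⊡ ex ⊞ + 5 * (y + + 2 * j + + 1) ⊡ ey)
          (solve (x ∷ y ∷ z ∷ i ∷ j ∷ q ∷ [])))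
        cases (inj₂ (i , ex)) (inj₁ (j , ey)) _ = ⊥-elim (indivisible (+ 1) (+ 4) (+ 3)
          (+ 8 * q + + 7 - + 3 * (i * i + i) - + 5 * (j * j) - + 3 * (z * z))
          (+ 1 ⊡ h ⊞ + 3 * (x + + 2 * i + + 1) ⊡ ex ⊞ + 5 * (y + + 2 * j) ⊡ ey)
          (solve (x ∷ y ∷ z ∷ i ∷ j ∷ q ∷ [])))
        cases (inj₂ ox) (inj₂ oy) (inj₂ oz) = inj₁ ((ox , oy , oz) , w)
        cases (inj₂ ox) (inj₂ oy) (inj₁ (l , ez)) = ⊥-elim (impossible (odd² x ox) (odd² y oy))
          where
          impossible : (∃ λ i → x * x ≡ + 8 * i + + 1) → (∃ λ j → y * y ≡ + 8 * j + + 1) → ⊥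
          impossible (i , ex) (j , ey) = indivisible (+ 1) (+ 8) (+ 20)
            (+ 3 * i + + 5 * j + + 6 * (l * l) - + 4 * q)
            (- + 1 ⊡ h ⊞ - + 3 ⊡ ex ⊞ - + 5 ⊡ ey ⊞ - + 12 * (z + + 2 * l) ⊡ ez)
            (solve (x ∷ y ∷ z ∷ i ∷ j ∷ l ∷ q ∷ []))

    card-double-even : ∀ {k} → HasCard S k → HasCard O (k ℕ.+ k)
    card-double-even = card-double f g f-injective (λ h → f-injective (cong swap₁₃ h))
                         f-sound (λ s → Sol-swap₁₃ (f-sound s)) onto apart

    card-odd∪even : ∀ {j k} → HasCard E j → HasCard O k → HasCard W (j ℕ.+ k)
    card-odd∪even c d = card-∪ c (card-Image f f-injective d) proj₂ (λ { (_ , o , refl) → f-sound′ o })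
      split λ { ((ox , _) , _) ((x , _ , _) , _ , refl) → ¬even∧odd (x , refl) ox }

  open Lift
  open Twist
  open Eisenstein
  open ThreeFiveTwelve

  -- Passage from the counting functions to solution sets, and from naturals to integers.

  card-N-Sol : ∀ a b c n .{{_ : ℕ.NonZero a}} .{{_ : ℕ.NonZero b}} .{{_ : ℕ.NonZero c}} →
               HasCard (Sol (+ a) (+ b) (+ c) (+ n)) (N a b c n)
  card-N-Sol a b c n = card-⇔ {P = λ p → + n ≡ Q a b c p} (λ { {_ , _ , _} e → sol e }) (λ { (sol e) → e }) (card-N a b c n)

  card-t-OddSol : ∀ a b c n .{{_ : ℕ.NonZero a}} .{{_ : ℕ.NonZero b}} .{{_ : ℕ.NonZero c}} →
                  HasCard (OddSol (+ a) (+ b) (+ c) (+ 8 * + n + (+ a + + b + + c))) (t a b c n)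
  card-t-OddSol a b c n = card-map {P = λ p → n ≡ T a b c p} f (λ {p} {p′} → f-injective {p} {p′})
                            (λ {p} → f-sound {p}) onto (card-t a b c n)
    where
    f : ℤ³ → ℤ³
    f (x , y , z) = twice+1 x , twice+1 y , twice+1 z

    twice+1-injective : ∀ x y → + 2 * x + + 1 ≡ + 2 * y + + 1 → x ≡ y
    twice+1-injective x y e = by-combination (+ 2) (+ 1 ⊡ e) (solve (x ∷ y ∷ []))

    f-injective : ∀ {p p′} → f p ≡ f p′ → p ≡ p′
    f-injective {x , y , z} {x′ , y′ , z′} h = let h₁ , h₂ , h₃ = triple-injective h in
      triple≡ (twice+1-injective x x′ h₁) (twice+1-injective y y′ h₂) (twice+1-injective z z′ h₃)

    f-sound : ∀ {p} → n ≡ T a b c p → OddSol (+ a) (+ b) (+ c) (+ 8 * + n + (+ a + + b + + c)) (f p)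
    f-sound {x , y , z} e = ((x , refl) , (y , refl) , (z , refl)) ,
      sol (trans (cong (λ k → + 8 * + k + (+ a + + b + + c)) e) (sym (Q-odd a b c x y z)))

    onto : ∀ {p} → OddSol (+ a) (+ b) (+ c) (+ 8 * + n + (+ a + + b + + c)) p →
           Image f (λ p → n ≡ T a b c p) p
    onto (((x , refl) , (y , refl) , (z , refl)) , sol e) = (x , y , z)
      , ℤ.+-injective (cancel (+ n) (+ T a b c (x , y , z)) (+ a + + b + + c)
                         (trans e (Q-odd a b c x y z)))
      , refl
      where
      cancel : ∀ u v s → + 8 * u + s ≡ + 8 * v + s → u ≡ v
      cancel u v s e = by-combination (+ 8) (+ 1 ⊡ e) (solve (u ∷ v ∷ s ∷ []))

  +-affine : ∀ a b r q → + (a ℕ.* (r ℕ.+ q ℕ.* 4) ℕ.+ b) ≡ + a * (+ r + + q * + 4) + + b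
  +-affine a b r q = cong (_+ + b) (trans (ℤ.pos-* a _) (cong (λ k → + a * (+ r + k)) (ℤ.pos-* q 4)))

  cast-Sol : ∀ {a b c m m′ k} → m ≡ m′ → HasCard (Sol a b c m) k → HasCard (Sol a b c m′) k
  cast-Sol refl c = c

  cast-OddSol : ∀ {a b c m m′ k} → m ≡ m′ → HasCard (OddSol a b c m) k → HasCard (OddSol a b c m′) k
  cast-OddSol refl c = c

  +-residue : ∀ r q → + (r ℕ.+ q ℕ.* 4) ≡ + r + + q * + 4
  +-residue r q = cong (_+_ (+ r)) (ℤ.pos-* q 4)

  double≡ : ∀ {m k} → m ≡ k → k ℕ.+ k ≡ 2 ℕ.* m
  double≡ {m} refl = cong (m ℕ.+_) (sym (ℕ.+-identityʳ m))

  -- The four identities, with n written as its residue plus 4q.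

  t-3-4-5 : ∀ q → let n = 3 ℕ.+ q ℕ.* 4 in t 3 4 5 n ≡ 2 ℕ.* N 3 4 5 (2 ℕ.* n ℕ.+ 3)
  t-3-4-5 q = trans (card-unique (card-t-OddSol 3 4 5 n) odd) (double≡ (card-unique (card-N-Sol 3 4 5 m) all))
    where
    n = 3 ℕ.+ q ℕ.* 4
    m = 2 ℕ.* n ℕ.+ 3
    -- The common measure of both sides: `all` counts `k` solutions for `N`, and `odd` counts twice
    -- as many for `t`.
    k = N 12 5 4 m

    base : ∀ {m′} → + 2 * (+ 3 + + q * + 4) + + 3 ≡ m′ → HasCard (Sol (+ 12) (+ 5) (+ 4) m′) k
    base e = cast-Sol (trans (+-affine 2 3 3 q) e) (card-N-Sol 12 5 4 m)

    all : HasCard (Sol (+ 3) (+ 4) (+ 5) (+ m)) k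
    all = cast-Sol (trans (sym (residue (+ q))) (sym (+-affine 2 3 3 q)))
            (card-Sol-swap₂₃ (card-halve-x (+ 1) (+ 2 * + q + + 2) (base (residue (+ q)))))
      where
      residue : ∀ u → + 2 * (+ 3 + u * + 4) + + 3 ≡ + 4 * (+ 2 * u + + 2) + + 1
      residue = solve-∀

    odd : HasCard (OddSol (+ 3) (+ 4) (+ 5) (+ 8 * + n + + 12)) (k ℕ.+ k)
    -- The terms z² + 3x² of 3x² + 5y² + z² form the Eisenstein part, with e = 1; the doubling comes
    -- from it, and the twist keeps the count.
    odd = cast-OddSol (trans (collect (+ q)) (cong (λ v → + 8 * v + + 12) (sym (+-residue 3 q))))
            (card-OddSol-swap₂₃ (card-twist (+ 1) (+ q) (cast-OddSol (shift (+ q))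
               (card-OddSol-swap₁₃ (card-OddSol-swap₂₃ (card-double-eisenstein (+ 1) (+ q) (+ 0 , refl)
                 (card-Sol-swap₂₃ (card-Sol-swap₁₃ (base (expand (+ q)))))))))))
      where
      expand : ∀ u → + 2 * (+ 3 + u * + 4) + + 3 ≡ + 8 * u + + 4 + + 5
      expand = solve-∀
      shift : ∀ u → + 8 * u + + 4 + + 5 ≡ + 1 + + 8 * u + + 8
      shift = solve-∀
      collect : ∀ u → + 4 * (+ 1 + + 8 * u + + 8) ≡ + 8 * (+ 3 + u * + 4) + + 12
      collect = solve-∀

  t-3-5-20 : ∀ q → let n = 1 ℕ.+ q ℕ.* 4 in t 3 5 20 n ≡ 2 ℕ.* N 3 5 20 (2 ℕ.* n ℕ.+ 7)
  t-3-5-20 q = trans (card-unique (card-t-OddSol 3 5 20 n) odd) (double≡ (card-unique (card-N-Sol 3 5 20 m) all))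
    where
    n = 1 ℕ.+ q ℕ.* 4
    m = 2 ℕ.* n ℕ.+ 7
    k = N 12 5 20 m

    base : ∀ {m′} → + 2 * (+ 1 + + q * + 4) + + 7 ≡ m′ → HasCard (Sol (+ 12) (+ 5) (+ 20) m′) k
    base e = cast-Sol (trans (+-affine 2 7 1 q) e) (card-N-Sol 12 5 20 m)

    all : HasCard (Sol (+ 3) (+ 5) (+ 20) (+ m)) k
    all = cast-Sol (trans (sym (residue (+ q))) (sym (+-affine 2 7 1 q)))
            (card-halve-x (+ 5) (+ 2 * + q + + 2) (base (residue (+ q))))
      where
      residue : ∀ u → + 2 * (+ 1 + u * + 4) + + 7 ≡ + 4 * (+ 2 * u + + 2) + + 1
      residue = solve-∀

    odd : HasCard (OddSol (+ 3) (+ 5) (+ 20) (+ 8 * + n + + 28)) (k ℕ.+ k)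
    odd = cast-OddSol (trans (collect (+ q)) (cong (λ v → + 8 * v + + 28) (sym (+-residue 1 q))))
            (card-double-lift (+ 5) (+ q) (+ 2 , refl) (card-Sol-swap₂₃ (base (expand (+ q)))))
      where
      expand : ∀ u → + 2 * (+ 1 + u * + 4) + + 7 ≡ + 5 + + 8 * u + + 4
      expand = solve-∀
      collect : ∀ u → + 4 * (+ 5 + + 8 * u + + 4) ≡ + 8 * (+ 1 + u * + 4) + + 28
      collect = solve-∀

  t-3-5-36 : ∀ q → let n = 3 ℕ.+ q ℕ.* 4 in t 3 5 36 n ≡ 2 ℕ.* N 3 5 36 (2 ℕ.* n ℕ.+ 11)
  t-3-5-36 q = trans (card-unique (card-t-OddSol 3 5 36 n) odd) (double≡ (card-unique (card-N-Sol 3 5 36 m) all))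
    where
    n = 3 ℕ.+ q ℕ.* 4
    m = 2 ℕ.* n ℕ.+ 11
    k = N 12 5 36 m

    base : ∀ {m′} → + 2 * (+ 3 + + q * + 4) + + 11 ≡ m′ → HasCard (Sol (+ 12) (+ 5) (+ 36) m′) k
    base e = cast-Sol (trans (+-affine 2 11 3 q) e) (card-N-Sol 12 5 36 m)

    all : HasCard (Sol (+ 3) (+ 5) (+ 36) (+ m)) k
    all = cast-Sol (trans (sym (residue (+ q))) (sym (+-affine 2 11 3 q)))
            (card-halve-x (+ 9) (+ 2 * + q + + 4) (base (residue (+ q))))
      where
      residue : ∀ u → + 2 * (+ 3 + u * + 4) + + 11 ≡ + 4 * (+ 2 * u + + 4) + + 1
      residue = solve-∀

    odd : HasCard (OddSol (+ 3) (+ 5) (+ 36) (+ 8 * + n + + 44)) (k ℕ.+ k)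
    -- In 3x² + 5y² + 9z² the Eisenstein part is 3(x² + 3z²), so e = 3.
    odd = cast-OddSol (trans (collect (+ q)) (cong (λ v → + 8 * v + + 44) (sym (+-residue 3 q))))
            (card-twist (+ 9) (+ q) (cast-OddSol (shift (+ q))
               (card-OddSol-swap₂₃ (card-double-eisenstein (+ 3) (+ q) (+ 1 , refl)
                 (card-Sol-swap₂₃ (base (expand (+ q))))))))
      where
      expand : ∀ u → + 2 * (+ 3 + u * + 4) + + 11 ≡ + 8 * u + + 12 + + 5
      expand = solve-∀
      shift : ∀ u → + 8 * u + + 12 + + 5 ≡ + 9 + + 8 * u + + 8
      shift = solve-∀
      collect : ∀ u → + 4 * (+ 9 + + 8 * u + + 8) ≡ + 8 * (+ 3 + u * + 4) + + 44
      collect = solve-∀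

  t-3-5-12 : ∀ q → let n = 1 ℕ.+ q ℕ.* 4 in 2 ℕ.* t 3 5 12 n ≡ N 3 5 12 (8 ℕ.* n ℕ.+ 20)
  t-3-5-12 q = trans (sym (double≡ (card-unique (card-t-OddSol 3 5 12 n) odd)))
                 (card-unique all (card-N-Sol 3 5 12 (8 ℕ.* n ℕ.+ 20)))
    where
    n = 1 ℕ.+ q ℕ.* 4
    m = 2 ℕ.* n ℕ.+ 5
    k = N 12 20 3 m

    base : ∀ {m′} → + 2 * (+ 1 + + q * + 4) + + 5 ≡ m′ → HasCard (Sol (+ 12) (+ 20) (+ 3) m′) k
    base e = cast-Sol (trans (+-affine 2 5 1 q) e) (card-N-Sol 12 20 3 m)

    lifted : HasCard (OddSol (+ 3) (+ 5) (+ 12) (+ 4 * (+ 3 + + 8 * + q + + 4))) (k ℕ.+ k)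
    lifted = card-double-lift (+ 3) (+ q) (+ 1 , refl) (base (expand (+ q)))
      where
      expand : ∀ u → + 2 * (+ 1 + u * + 4) + + 5 ≡ + 3 + + 8 * u + + 4
      expand = solve-∀

    odd : HasCard (OddSol (+ 3) (+ 5) (+ 12) (+ 8 * + n + + 20)) (k ℕ.+ k)
    odd = cast-OddSol (trans (collect (+ q)) (cong (λ v → + 8 * v + + 20) (sym (+-residue 1 q)))) lifted
      where
      collect : ∀ u → + 4 * (+ 3 + + 8 * u + + 4) ≡ + 8 * (+ 1 + u * + 4) + + 20
      collect = solve-∀

    -- One `k ℕ.+ k` counts the odd solutions, which are those of `t`, and the other counts the
    -- solutions with x and y even.
    all : HasCard (Sol (+ 3) (+ 5) (+ 12) (+ (8 ℕ.* n ℕ.+ 20))) ((k ℕ.+ k) ℕ.+ (k ℕ.+ k))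
    all = cast-Sol (trans (collect (+ q)) (sym (+-affine 8 20 1 q)))
            (card-odd∪even (+ q) (cast-OddSol (cong (_*_ (+ 4)) (shift (+ q))) lifted)
                           (card-double-even (+ q) (base (expand (+ q)))))
      where
      expand : ∀ u → + 2 * (+ 1 + u * + 4) + + 5 ≡ + 8 * u + + 7
      expand = solve-∀
      shift : ∀ u → + 3 + + 8 * u + + 4 ≡ + 8 * u + + 7
      shift = solve-∀
      collect : ∀ u → + 4 * (+ 8 * u + + 7) ≡ + 8 * (+ 1 + u * + 4) + + 20
      collect = solve-∀

open Forms using (t-3-4-5; t-3-5-20; t-3-5-36; t-3-5-12)

open import Data.Nat using (ℕ; _+_; _*_; _%_; _≡ᵇ_)

theorem6p1 : (n : ℕ) → 1 Data.Nat.≤ n →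
    (n % 4 ≡ 3 → t 3 4 5 n ≡ 2 * N 3 4 5 (2 * n + 3))
    × (n % 4 ≡ 1 → t 3 5 20 n ≡ 2 * N 3 5 20 (2 * n + 7))
    × (n % 4 ≡ 3 → t 3 5 36 n ≡ 2 * N 3 5 36 (2 * n + 11))
    × (n % 4 ≡ 1 → 2 * t 3 5 12 n ≡ N 3 5 12 (8 * n + 20))
theorem6p1 n _ =
    transport (λ n → t 3 4 5 n ≡ 2 * N 3 4 5 (2 * n + 3)) 3 t-3-4-5
  , transport (λ n → t 3 5 20 n ≡ 2 * N 3 5 20 (2 * n + 7)) 1 t-3-5-20
  , transport (λ n → t 3 5 36 n ≡ 2 * N 3 5 36 (2 * n + 11)) 3 t-3-5-36
  , transport (λ n → 2 * t 3 5 12 n ≡ N 3 5 12 (8 * n + 20)) 1 t-3-5-12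
  where
  transport : ∀ (P : ℕ → Set) r → (∀ q → P (r + q * 4)) → n % 4 ≡ r → P n
  transport P _ f refl = subst P (sym (m≡m%n+[m/n]*n n 4)) (f (n / 4))
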